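{- For every integer $n\ge 0$, \[ \overline{p}_o(2n)=\overline{p}(n)+2\sum_{k=1}^{\infty}\overline{p}(n-2k^2). \]
   Context: An overpartition of $n$ is a partition of $n$ in which the first occurrence of each part size may be overlined. $\overline{p}(n)$ is the number of overpartitions of $n$, with $\sum_{n\ge0}\overline{p}(n)q^n=\frac{(-q;q)_\infty}{(q;q)_\infty}$; $\overline{p}_o(n)$ is the number of overpartitions of $n$ into odd parts, with $\sum_{n\ge0}\overline{p}_o(n)q^n=\frac{(-q;q^2)_\infty}{(q;q^2)_\infty}$, where $(a;q)_\infty=\prod_{k\ge1}(1-aq^{k-1})$. Convention: $\overline{p}(x)=0$ whenever $x$ is not a nonnegative integer. -}

module Defs where

open import Data.Nat using (ℕ; zero; suc; _+_; _*_; _≡ᵇ_; _%_)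
open import Data.Bool using (Bool; true; false; _∧_; if_then_else_)
open import Data.Product using (_×_; _,_)
open import Data.List using (List; []; _∷_; length; filter; concatMap; map; upTo; sum)
open import Data.Vec using (Vec; []; _∷_)
open import Data.Integer using (ℤ; +_; -[1+_])
open import Relation.Binary.PropositionalEquality using (_≡_)
open import Relation.Nullary.Decidable using (Dec)
open import Data.Bool.Properties using (_≟_)

-- An overpartition is encoded by its multiplicity data: for each part size
-- j = 1, 2, ..., L we record (m_j , o_j) where m_j is the number of parts of
-- size j and o_j says whether the first occurrence of j is overlined.
-- Validity: o_j can only be true if m_j ≥ 1.
Slot : Set
Slot = ℕ × Bool

allSlots : ℕ → List Slot
allSlots B = concatMap (λ m → (m , false) ∷ (m , true) ∷ []) (upTo (suc B))

allVecs : (L B : ℕ) → List (Vec Slot L)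
allVecs zero    B = [] ∷ []
allVecs (suc L) B = concatMap (λ s → map (s ∷_) (allVecs L B)) (allSlots B)

weight : ∀ {L} → ℕ → Vec Slot L → ℕ
weight j [] = 0
weight j ((m , _) ∷ v) = j * m + weight (suc j) v

validSlot : Slot → Bool
validSlot (zero , true) = false
validSlot _ = true

valid : ∀ {L} → Vec Slot L → Bool
valid [] = true
valid (s ∷ v) = validSlot s ∧ valid v

oddParts : ∀ {L} → ℕ → Vec Slot L → Bool
oddParts j [] = true
oddParts j ((m , _) ∷ v) = (if (j % 2) ≡ᵇ 0 then m ≡ᵇ 0 else true) ∧ oddParts (suc j) v

isOverpartitionOf : (n : ℕ) → Vec Slot n → Bool
isOverpartitionOf n v = valid v ∧ (weight 1 v ≡ᵇ n)

-- every overpartition of n has parts ≤ n and multiplicities ≤ n, so it is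
-- represented by exactly one vector in allVecs n n
overpartitionsOf : (n : ℕ) → List (Vec Slot n)
overpartitionsOf n = filter (λ v → isOverpartitionOf n v ≟ true) (allVecs n n)

oddOverpartitionsOf : (n : ℕ) → List (Vec Slot n)
oddOverpartitionsOf n =
  filter (λ v → (isOverpartitionOf n v ∧ oddParts 1 v) ≟ true) (allVecs n n)

pbar : ℕ → ℕ
pbar n = length (overpartitionsOf n)

pbarO : ℕ → ℕ
pbarO n = length (oddOverpartitionsOf n)

pbarℤ : ℤ → ℕ
pbarℤ (+ n) = pbar n
pbarℤ -[1+ _ ] = 0

sumFrom1 : ℕ → (ℕ → ℕ) → ℕ
sumFrom1 zero f = 0
sumFrom1 (suc K) f = sumFrom1 K f + f (suc K)

{-# OPTIONS --safe #-}
-- Write P(q) and Pₒ(q) for the two generating functions. Both are products of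
-- (1 + q^k) / (1 - q^k), over all k and over odd k. Gauss' identity
-- Σ_{j∈ℤ} (-q)^(j²) = ∏ (1 - q^k) / (1 + q^k), with q replaced by -q, gives
-- Pₒ(q) = Σ_{j∈ℤ} q^(j²) · P(q²). In degree 2n only even j = 2k contribute, and
-- the coefficient there is Σ_{k∈ℤ} p̄(n - 2k²).
-- All of this takes place in the ring of power series truncated at a fixed degree,
-- where the products are finite and x^M = 0; Gauss' identity then follows from
-- Shanks' finite summation formula.
module Submission where

open import Defs
open import Data.Nat as ℕ using (ℕ; zero; suc; z≤n; s≤s; _%_; _≡ᵇ_)
open import Data.Nat.Properties as ℕₚ using ()
open import Data.Nat.Tactic.RingSolver using () renaming (solve-∀ to ℕ-solve-∀)
open import Data.Integer as ℤ using (ℤ; +_; _-_)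
open import Data.Integer.Properties as ℤₚ using ()
open import Data.Integer.Tactic.RingSolver using () renaming (solve-∀ to ℤ-solve-∀)
open import Data.Bool using (Bool; true; false; _∧_; if_then_else_)
open import Data.Bool.Properties using (_≟_; ∧-assoc; ∧-comm; ∧-zeroʳ; ∧-identityʳ)
open import Data.Vec using (Vec; []; _∷_)
open import Data.List using (List; []; _∷_; _++_; map; concatMap; applyUpTo; upTo; length; filter)
open import Data.Product using (_,_)
open import Data.Sum using (inj₁; inj₂)
open import Algebra.Bundles using (CommutativeRing)
open import Function using (_∘_)
open import Level using (0ℓ)
open import Relation.Binary.PropositionalEquality as ≡ using (_≡_)

-- The algebra is done over an arbitrary commutative ring, with nilpotency of `q` as the only
-- assumption on it; power series enter only when coefficients are read off. Shanks' formula suits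
-- this setting because it is a polynomial identity provable by induction, with an explicit
-- remainder that truncation kills. Quotients are either cross-multiplied or replaced by finite
-- geometric sums, which invert `1 - y` exactly for nilpotent `y`. A second difficulty lies in the
-- counting: `pbar m` enumerates a box depending on `m` (parts and multiplicities at most `m`),
-- whereas a single product in degree 2n has to supply the overpartition numbers of all n - 2k² at
-- once, from the one box of `n`. Hence the results on enlarging the box.

double : ℕ → ℕ
double zero    = zero
double (suc n) = suc (suc (double n))

-- Conditions imposed one part size at a time factor over the slots, so unrestricted overpartitions
-- and those into odd parts share one product formula.
allowed : (ℕ → ℕ → Bool) → ∀ {L} → ℕ → Vec Slot L → Bool
allowed P j []            = true
allowed P j ((m , _) ∷ v) = P j m ∧ allowed P (suc j) v

module Identities {c ℓ} (R : CommutativeRing c ℓ) where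
  open CommutativeRing R
  open import Algebra.Properties.Ring ring
  open import Algebra.Properties.CommutativeSemiring.Exp commutativeSemiring
  open import Algebra.Solver.Ring.NaturalCoefficients.Default commutativeSemiring using (solve; _:=_; _:+_; _:*_; con)
  open import Relation.Binary.Reasoning.Setoid setoid

  2# : Carrier
  2# = 1# + 1#

  -- Finite products

  ∏ : (ℕ → Carrier) → ℕ → ℕ → Carrier
  ∏ f j zero    = 1#
  ∏ f j (suc n) = f j * ∏ f (suc j) n

  ∏-snoc : ∀ f j n → ∏ f j (suc n) ≈ ∏ f j n * f (j ℕ.+ n)
  ∏-snoc f j zero rewrite ℕₚ.+-identityʳ j = *-comm (f j) 1#
  ∏-snoc f j (suc n) = begin
    f j * ∏ f (suc j) (suc n)                      ≈⟨ *-congˡ (∏-snoc f (suc j) n) ⟩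
    f j * (∏ f (suc j) n * f (suc j ℕ.+ n))        ≈⟨ *-assoc (f j) _ _ ⟨
    f j * ∏ f (suc j) n * f (suc j ℕ.+ n)          ≡⟨ ≡.cong (λ k → f j * ∏ f (suc j) n * f k) (ℕₚ.+-suc j n) ⟨
    f j * ∏ f (suc j) n * f (j ℕ.+ suc n)          ∎

  ∏-cong : ∀ {f g} j n → (∀ i → j ℕ.≤ i → f i ≈ g i) → ∏ f j n ≈ ∏ g j n
  ∏-cong j zero    p = refl
  ∏-cong j (suc n) p = *-cong (p j ℕₚ.≤-refl) (∏-cong (suc j) n (λ i j<i → p i (ℕₚ.<⇒≤ j<i)))

  ∏-* : ∀ f g j n → ∏ (λ i → f i * g i) j n ≈ ∏ f j n * ∏ g j n
  ∏-* f g j zero    = sym (*-identityˡ 1#)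
  ∏-* f g j (suc n) = trans (*-congˡ (∏-* f g (suc j) n))
    (solve 4 (λ a b x y → a :* b :* (x :* y) := a :* x :* (b :* y)) refl
      (f j) (g j) (∏ f (suc j) n) (∏ g (suc j) n))

  ∏-1 : ∀ {f} j n → (∀ i → j ℕ.≤ i → f i ≈ 1#) → ∏ f j n ≈ 1#
  ∏-1 j zero    p = refl
  ∏-1 j (suc n) p = trans (*-cong (p j ℕₚ.≤-refl) (∏-1 (suc j) n (λ i j<i → p i (ℕₚ.<⇒≤ j<i)))) (*-identityˡ 1#)

  ∏-double : ∀ f j n → ∏ f (suc (double j)) (double n) ≈
             ∏ (f ∘ suc ∘ double) j n * ∏ (f ∘ double) (suc j) n
  ∏-double f j zero    = sym (*-identityˡ 1#)
  ∏-double f j (suc n) = trans (*-congˡ (*-congˡ (∏-double f (suc j) n)))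
    (solve 4 (λ a b x y → a :* (b :* (x :* y)) := a :* x :* (b :* y)) refl
      (f (suc (double j))) (f (double (suc j))) _ _)

  -- Shanks' summation: with y = -x^(n+1), the right-hand side of shanks-sum is
  -- the partial theta series times ∏ (1 + x^k), and the left-hand side differs
  -- from ∏ (1 - x^k) by a multiple of x^(n+1).
  module Shanks (x : Carrier) where

    plus minus : ℕ → Carrier
    plus  k = 1# + x ^ k
    minus k = 1# + - x ^ k

    -- T y r d = Σ_{i<d} yⁱ ∏_{k=r+i+2}^{r+d} (1 - x^k) ∏_{k=1}^{r+i} (1 + x^k)
    T : Carrier → ℕ → ℕ → Carrier
    T y r zero    = 0#
    T y r (suc d) = ∏ minus (suc (suc r)) d * ∏ plus 1 r + y * T y (suc r) d

    -- Compares the remainder at `w * x`, that is `- x ^ suc n`, with the one at `w`; for `r = 0`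
    -- this is the inductive step of `shanks-sum`. Since `T` recurses by raising `r` and lowering
    -- `d`, the induction needs every `r`, while `n`, the sum r + d + 1, and hence `w` stay fixed.
    T-step : ∀ w r d n → suc (r ℕ.+ d) ≡ n → w ≈ - x ^ n →
             x ^ suc r * T (w * x) r (suc d) + ∏ minus (suc r) d * ∏ plus 1 r ≈
             (1# + x ^ n) * T w r d + w ^ d * ∏ plus 1 n
    T-step w r zero n eq w≈ = begin
      x ^ suc r * (1# * ∏ plus 1 r + w * x * 0#) + 1# * ∏ plus 1 r
        ≈⟨ solve 5 (λ X P w x xn → X :* (con 1 :* P :+ w :* x :* con 0) :+ con 1 :* P :=
                                (con 1 :+ xn) :* con 0 :+ con 1 :* (P :* (con 1 :+ X))) refl
             (x ^ suc r) (∏ plus 1 r) w x (x ^ n) ⟩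
      (1# + x ^ n) * 0# + 1# * (∏ plus 1 r * plus (suc r))
        ≈⟨ +-congˡ (*-congˡ (∏-snoc plus 1 r)) ⟨
      (1# + x ^ n) * 0# + 1# * ∏ plus 1 (suc r)
        ≡⟨ ≡.cong (λ k → (1# + x ^ n) * 0# + 1# * ∏ plus 1 k) (≡.trans (≡.cong suc (≡.sym (ℕₚ.+-identityʳ r))) eq) ⟩
      (1# + x ^ n) * 0# + 1# * ∏ plus 1 n ∎
    T-step w r (suc d) n eq w≈ = begin
      X * (∏ minus (suc (suc r)) (suc d) * b + w * x * t) + minus (suc r) * a * b
        ≈⟨ +-congʳ (*-congˡ (+-congʳ (*-congʳ (∏-snoc minus (suc (suc r)) d)))) ⟩
      X * (a * minus (suc (suc r) ℕ.+ d) * b + w * x * t) + (1# + - X) * a * b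
        ≡⟨ ≡.cong (λ k → X * (a * minus k * b + w * x * t) + (1# + - X) * a * b) n≡ ⟩
      X * (a * (1# + - p) * b + w * x * t) + (1# + - X) * a * b
        ≈⟨ +-congʳ (*-congˡ (+-congʳ (*-congʳ (*-congˡ (+-congˡ w≈))))) ⟨
      X * (a * (1# + w) * b + w * x * t) + (1# + - X) * a * b
        -- `p + w` is zero. Once it is added, both sides agree with `p`, `w` and `- X` as
        -- independent symbols, and only `X + - X` is left to cancel.
        ≈⟨ +-congˡ (*-congʳ (*-congʳ 1-X≈)) ⟩
      X * (a * (1# + w) * b + w * x * t) + (1# + - X + (p + w)) * a * b
        ≈⟨ solve 8 (λ X a b w x t nX p →
             X :* (a :* (con 1 :+ w) :* b :+ w :* x :* t) :+ (con 1 :+ nX :+ (p :+ w)) :* a :* b :=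
             w :* (X :* x :* t :+ a :* (b :* (con 1 :+ X))) :+ (con 1 :+ p :+ (X :+ nX)) :* a :* b) refl
             X a b w x t (- X) p ⟩
      w * (X * x * t + a * (b * plus (suc r))) + (1# + p + (X + - X)) * a * b
        ≈⟨ +-cong (*-congˡ (+-cong (*-congʳ (*-comm X x)) (*-congˡ (sym (∏-snoc plus 1 r)))))
                  (*-congʳ (*-congʳ (+-congˡ (-‿inverseʳ X)))) ⟩
      w * (x * X * t + a * ∏ plus 1 (suc r)) + (1# + p + 0#) * a * b
        ≈⟨ +-congʳ (*-congˡ (T-step w (suc r) d n n≡ w≈)) ⟩
      w * ((1# + p) * u + w ^ d * ∏ plus 1 n) + (1# + p + 0#) * a * b
        ≈⟨ solve 7 (λ w p u v C a b →
             w :* ((con 1 :+ p) :* u :+ v :* C) :+ (con 1 :+ p :+ con 0) :* a :* b :=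
             (con 1 :+ p) :* (a :* b :+ w :* u) :+ w :* v :* C) refl
             w p u (w ^ d) (∏ plus 1 n) a b ⟩
      (1# + p) * (a * b + w * u) + w * w ^ d * ∏ plus 1 n ∎
      where
      X = x ^ suc r
      a = ∏ minus (suc (suc r)) d
      b = ∏ plus 1 r
      t = T (w * x) (suc r) (suc d)
      u = T w (suc r) d
      p = x ^ n
      n≡ : suc (suc r) ℕ.+ d ≡ n
      n≡ = ≡.trans (≡.cong suc (≡.sym (ℕₚ.+-suc r d))) eq

      1-X≈ : 1# + - X ≈ 1# + - X + (p + w)
      1-X≈ = sym (trans (+-congˡ (trans (+-congˡ w≈) (-‿inverseʳ p))) (+-identityʳ _))

    -- Since (-x^j)^j = (-1)^j x^(j²), this is the theta sum over |j| ≤ n with j and -j paired. As a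
    -- power of `- x ^ j`, each term is what `T-step` produces from `w ^ d`.
    Θ : ℕ → Carrier
    Θ zero    = 1#
    Θ (suc n) = Θ n + 2# * (- x ^ suc n) ^ suc n

    T-cong : ∀ {y z} → y ≈ z → ∀ r d → T y r d ≈ T z r d
    T-cong y≈z r zero    = refl
    T-cong y≈z r (suc d) = +-congˡ (*-cong y≈z (T-cong y≈z (suc r) d))

    shanks-sum : ∀ n → ∏ minus 1 n + 2# * (- x ^ suc n) * T (- x ^ suc n) 0 n ≈ Θ n * ∏ plus 1 n
    shanks-sum zero    = solve 1 (λ y → con 1 :+ con 2 :* y :* con 0 := con 1 :* con 1) refl (- x ^ 1)
    shanks-sum (suc n) = begin
      ∏ minus 1 (suc n) + 2# * y * T y 0 (suc n)
        ≈⟨ +-cong (trans (∏-snoc minus 1 n) (*-congˡ 1+w≈)) (*-cong (*-congˡ y≈) (T-cong y≈ 0 (suc n))) ⟩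
      A * (1# + w + (p + w)) + 2# * (w * x) * t
        ≈⟨ solve 5 (λ A w p x t →
             A :* (con 1 :+ w :+ (p :+ w)) :+ con 2 :* (w :* x) :* t :=
             (con 1 :+ p) :* A :+ con 2 :* w :* (x :* con 1 :* t :+ A :* con 1)) refl
             A w p x t ⟩
      (1# + p) * A + 2# * w * (x ^ 1 * t + A * 1#)
        ≈⟨ +-congˡ (*-congˡ (T-step w 0 n (suc n) ≡.refl refl)) ⟩
      (1# + p) * A + 2# * w * ((1# + p) * T w 0 n + w ^ n * ∏ plus 1 (suc n))
        ≈⟨ solve 6 (λ A w p u v C →
             (con 1 :+ p) :* A :+ con 2 :* w :* ((con 1 :+ p) :* u :+ v :* C) :=
             (A :+ con 2 :* w :* u) :* (con 1 :+ p) :+ con 2 :* (w :* v) :* C) refl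
             A w p (T w 0 n) (w ^ n) (∏ plus 1 (suc n)) ⟩
      (A + 2# * w * T w 0 n) * (1# + p) + 2# * w ^ suc n * ∏ plus 1 (suc n)
        ≈⟨ +-congʳ (*-congʳ (shanks-sum n)) ⟩
      Θ n * ∏ plus 1 n * (1# + p) + 2# * w ^ suc n * ∏ plus 1 (suc n)
        ≈⟨ +-congʳ (trans (*-assoc _ _ _) (*-congˡ (sym (∏-snoc plus 1 n)))) ⟩
      Θ n * ∏ plus 1 (suc n) + 2# * w ^ suc n * ∏ plus 1 (suc n)
        ≈⟨ distribʳ _ _ _ ⟨
      (Θ n + 2# * w ^ suc n) * ∏ plus 1 (suc n) ∎
      where
      p = x ^ suc n
      w = - p
      y = - x ^ suc (suc n)
      A = ∏ minus 1 n
      t = T (w * x) 0 (suc n)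
      y≈ : y ≈ w * x
      y≈ = trans (-‿cong (*-comm x p)) (-‿distribˡ-* p x)
      1+w≈ : 1# + w ≈ 1# + w + (p + w)
      1+w≈ = sym (trans (+-congˡ (-‿inverseʳ p)) (+-identityʳ _))

  neg-square : ∀ y → - y * - y ≈ y * y
  neg-square y = trans (sym (-‿distribˡ-* y (- y))) (trans (-‿cong (sym (-‿distribʳ-* y y))) (-‿involutive (y * y)))

  neg-^-double : ∀ y i → (- y) ^ double i ≈ y ^ double i
  neg-^-double y zero    = refl
  neg-^-double y (suc i) = begin
    - y * (- y * (- y) ^ double i)  ≈⟨ *-assoc (- y) (- y) _ ⟨
    - y * - y * (- y) ^ double i    ≈⟨ *-cong (neg-square y) (neg-^-double y i) ⟩
    y * y * y ^ double i            ≈⟨ *-assoc y y _ ⟩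
    y * (y * y ^ double i)          ∎

  neg-^-suc-double : ∀ y i → (- y) ^ suc (double i) ≈ - y ^ suc (double i)
  neg-^-suc-double y i = trans (*-congˡ (neg-^-double y i)) (sym (-‿distribˡ-* y (y ^ double i)))

  square-^-double : ∀ y i → (y * y) ^ i ≈ y ^ double i
  square-^-double y zero    = refl
  square-^-double y (suc i) = trans (*-congˡ (square-^-double y i)) (*-assoc y y _)

  θ : Carrier → ℕ → Carrier
  θ q zero    = 1#
  θ q (suc n) = θ q n + 2# * q ^ (suc n ℕ.* suc n)

  -- The substitution q ↦ -q turns the factors 1 ± x^k with k odd into 1 ∓ q^k,
  -- and the alternating theta series into θ.
  module _ (q : Carrier) where
    open Shanks (- q)

    Θ-term-even : ∀ i → (- (- q) ^ double i) ^ double i ≈ q ^ (double i ℕ.* double i)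
    Θ-term-even i = begin
      (- (- q) ^ double i) ^ double i  ≈⟨ neg-^-double _ i ⟩
      ((- q) ^ double i) ^ double i    ≈⟨ ^-congˡ (double i) (neg-^-double q i) ⟩
      (q ^ double i) ^ double i        ≈⟨ ^-assocʳ q (double i) (double i) ⟩
      q ^ (double i ℕ.* double i)      ∎

    Θ-term-odd : ∀ k i → k ≡ suc (double i) → (- (- q) ^ k) ^ k ≈ q ^ (k ℕ.* k)
    Θ-term-odd k i ≡.refl = trans
      (^-congˡ k (trans (-‿cong (neg-^-suc-double q i)) (-‿involutive _)))
      (^-assocʳ q k k)

    Θ≈θ : ∀ i → Θ (double i) ≈ θ q (double i)
    Θ≈θ zero    = refl
    Θ≈θ (suc i) = +-cong (+-cong (Θ≈θ i) (*-congˡ (Θ-term-odd _ i ≡.refl))) (*-congˡ (Θ-term-even (suc i)))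

    -- This is `shanks-sum` at `- q`, whose remainder contains the factor q^(2N+1), zero by
    -- hypothesis. Cross-multiplication avoids all inverses, and the even length 2N yields `N`
    -- factors of each parity.
    gauss : ∀ N → q ^ suc (double N) ≈ 0# →
      θ q (double N) * (∏ (λ i → 1# + - q ^ suc (double i)) 0 N * ∏ (λ i → 1# + q ^ double i) 1 N) ≈
      ∏ (λ i → 1# + q ^ suc (double i)) 0 N * ∏ (λ i → 1# + - q ^ double i) 1 N
    gauss N nil = begin
      θ q (double N) * (∏ (λ i → 1# + - q ^ suc (double i)) 0 N * ∏ (λ i → 1# + q ^ double i) 1 N)
        ≈⟨ *-cong (Θ≈θ N) (*-cong (∏-cong 0 N (λ i _ → +-congˡ (neg-^-suc-double q i)))
                                   (∏-cong 1 N (λ i _ → +-congˡ (neg-^-double q i)))) ⟨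
      Θ (double N) * (∏ (plus ∘ suc ∘ double) 0 N * ∏ (plus ∘ double) 1 N)
        ≈⟨ *-congˡ (∏-double plus 0 N) ⟨
      Θ (double N) * ∏ plus 1 (double N)
        ≈⟨ shanks-sum (double N) ⟨
      ∏ minus 1 (double N) + 2# * y * T y 0 (double N)
        ≈⟨ +-congˡ (trans (*-congʳ (trans (*-congˡ y≈0) (zeroʳ 2#))) (zeroˡ _)) ⟩
      ∏ minus 1 (double N) + 0#
        ≈⟨ +-identityʳ _ ⟩
      ∏ minus 1 (double N)
        ≈⟨ ∏-double minus 0 N ⟩
      ∏ (minus ∘ suc ∘ double) 0 N * ∏ (minus ∘ double) 1 N
        ≈⟨ *-cong (∏-cong 0 N (λ i _ → +-congˡ (trans (-‿cong (neg-^-suc-double q i)) (-‿involutive _))))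
                  (∏-cong 1 N (λ i _ → +-congˡ (-‿cong (neg-^-double q i)))) ⟩
      ∏ (λ i → 1# + q ^ suc (double i)) 0 N * ∏ (λ i → 1# + - q ^ double i) 1 N ∎
      where
      y = - (- q) ^ suc (double N)
      y≈0 : y ≈ 0#
      y≈0 = trans (-‿cong (trans (neg-^-suc-double q N) (trans (-‿cong nil) -0#≈0#))) -0#≈0#

  -- Geometric sums and the factor (1 + y) / (1 - y)

  geometric : Carrier → ℕ → Carrier
  geometric y zero    = 0#
  geometric y (suc n) = 1# + y * geometric y n

  geometric-snoc : ∀ y n → geometric y (suc n) ≈ geometric y n + y ^ n
  geometric-snoc y zero    = solve 1 (λ y → con 1 :+ y :* con 0 := con 0 :+ con 1) refl y
  geometric-snoc y (suc n) = trans (+-congˡ (*-congˡ (geometric-snoc y n)))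
    (solve 3 (λ y g z → con 1 :+ y :* (g :+ z) := con 1 :+ y :* g :+ y :* z) refl y (geometric y n) (y ^ n))

  -- The factor 2 counts the choice of overlining the first occurrence.
  slot : ℕ → Carrier → Carrier
  slot B y = 1# + 2# * (y * geometric y B)

  slot-cong : ∀ B {y z} → y ≈ z → slot B y ≈ slot B z
  slot-cong B y≈z = +-congˡ (*-congˡ (*-cong y≈z (geometric-cong B)))
    where
    geometric-cong : ∀ n → geometric _ n ≈ geometric _ n
    geometric-cong zero    = refl
    geometric-cong (suc n) = +-congˡ (*-cong y≈z (geometric-cong n))

  -- The sides differ by `y ^ suc B` alone. This one vanishing term gives both the inverse of 1 - y
  -- and the independence from the multiplicity bound.
  geometric-stable : ∀ y B → y ^ suc B ≈ 0# → y * geometric y (suc B) ≈ y * geometric y B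
  geometric-stable y B nil = begin
    y * geometric y (suc B)        ≈⟨ *-congˡ (geometric-snoc y B) ⟩
    y * (geometric y B + y ^ B)    ≈⟨ distribˡ y _ _ ⟩
    y * geometric y B + y ^ suc B  ≈⟨ +-congˡ nil ⟩
    y * geometric y B + 0#         ≈⟨ +-identityʳ _ ⟩
    y * geometric y B              ∎

  geometric-inverse : ∀ y B → y ^ suc B ≈ 0# → (1# + - y) * geometric y (suc B) ≈ 1#
  geometric-inverse y B nil = begin
    (1# + - y) * g                         ≈⟨ distribʳ g 1# (- y) ⟩
    1# * g + - y * g                       ≈⟨ +-cong (*-identityˡ g) (sym (-‿distribˡ-* y g)) ⟩
    1# + y * geometric y B + - (y * g)     ≈⟨ +-congˡ (-‿cong (geometric-stable y B nil)) ⟩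
    1# + y * geometric y B + - (y * geometric y B) ≈⟨ +-assoc _ _ _ ⟩
    1# + (y * geometric y B + - (y * geometric y B)) ≈⟨ +-congˡ (-‿inverseʳ _) ⟩
    1# + 0#                                ≈⟨ +-identityʳ 1# ⟩
    1#                                     ∎
    where g = geometric y (suc B)

  -- Let z = y + ... + y^B and g = 1 + z, the inverse of 1 - y. By nilpotency z = y g, so 1 + 2z = g
  -- + z = (1 + y) g.
  slot-factor : ∀ y B → y ^ suc B ≈ 0# → slot B y ≈ (1# + y) * geometric y (suc B)
  slot-factor y B nil = begin
    1# + 2# * (y * geometric y B)  ≈⟨ solve 1 (λ z → con 1 :+ con 2 :* z := con 1 :* (con 1 :+ z) :+ z) refl (y * geometric y B) ⟩
    1# * g + y * geometric y B     ≈⟨ +-congˡ (geometric-stable y B nil) ⟨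
    1# * g + y * g                 ≈⟨ distribʳ g 1# y ⟨
    (1# + y) * g                   ∎
    where g = geometric y (suc B)

  ∏-slot-factor : ∀ (f : ℕ → Carrier) B j n → (∀ i → j ℕ.≤ i → f i ^ suc B ≈ 0#) →
    ∏ (slot B ∘ f) j n ≈ ∏ (λ i → 1# + f i) j n * ∏ (λ i → geometric (f i) (suc B)) j n
  ∏-slot-factor f B j n nil = trans
    (∏-cong j n (λ i j≤i → slot-factor (f i) B (nil i j≤i)))
    (∏-* (λ i → 1# + f i) (λ i → geometric (f i) (suc B)) j n)

  ∏-inverse : ∀ (f : ℕ → Carrier) B j n → (∀ i → j ℕ.≤ i → f i ^ suc B ≈ 0#) →
    ∏ (λ i → 1# + - f i) j n * ∏ (λ i → geometric (f i) (suc B)) j n ≈ 1#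
  ∏-inverse f B j n nil = trans
    (sym (∏-* (λ i → 1# + - f i) (λ i → geometric (f i) (suc B)) j n))
    (∏-1 j n (λ i j≤i → geometric-inverse (f i) B (nil i j≤i)))

  -- The truncated form of Pₒ(q) = θ(q) P(q²). Inserting E⁻Eᵍ = 1 creates one side of `gauss`; on
  -- the other side O⁻Oᵍ = 1 drops out. The bounds `B` and `B′` are separate because the two sides
  -- come from the boxes of 2n and of n.
  odd≈θ*even : ∀ q N B B′ → q ^ suc (double N) ≈ 0# →
    (∀ i → (q ^ suc (double i)) ^ suc B ≈ 0#) → (∀ i → 1 ℕ.≤ i → (q ^ double i) ^ suc B′ ≈ 0#) →
    ∏ (λ i → slot B (q ^ suc (double i))) 0 N ≈ θ q (double N) * ∏ (λ i → slot B′ (q ^ double i)) 1 N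
  odd≈θ*even q N B B′ nil nil-odd nil-even = begin
    ∏ (λ i → slot B (q ^ suc (double i))) 0 N ≈⟨ ∏-slot-factor odd B 0 N (λ i _ → nil-odd i) ⟩
    O⁺ * Oᵍ                            ≈⟨ *-identityʳ _ ⟨
    O⁺ * Oᵍ * 1#                       ≈⟨ *-congˡ (∏-inverse even B′ 1 N nil-even) ⟨
    O⁺ * Oᵍ * (E⁻ * Eᵍ)                ≈⟨ solve 4 (λ a b c d → a :* b :* (c :* d) := a :* c :* (b :* d)) refl O⁺ Oᵍ E⁻ Eᵍ ⟩
    O⁺ * E⁻ * (Oᵍ * Eᵍ)                ≈⟨ *-congʳ (gauss q N nil) ⟨
    t * (O⁻ * E⁺) * (Oᵍ * Eᵍ)          ≈⟨ solve 5 (λ t a b c d → t :* (a :* b) :* (c :* d) := t :* (b :* d) :* (a :* c)) refl t O⁻ E⁺ Oᵍ Eᵍ ⟩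
    t * (E⁺ * Eᵍ) * (O⁻ * Oᵍ)          ≈⟨ *-congˡ (∏-inverse odd B 0 N (λ i _ → nil-odd i)) ⟩
    t * (E⁺ * Eᵍ) * 1#                 ≈⟨ *-identityʳ _ ⟩
    t * (E⁺ * Eᵍ)                      ≈⟨ *-congˡ (∏-slot-factor even B′ 1 N nil-even) ⟨
    t * ∏ (λ i → slot B′ (q ^ double i)) 1 N ∎
    where
    t = θ q (double N)
    odd even : ℕ → Carrier
    odd  i = q ^ suc (double i)
    even i = q ^ double i
    O⁺ = ∏ (λ i → 1# + odd i) 0 N
    O⁻ = ∏ (λ i → 1# + - odd i) 0 N
    Oᵍ = ∏ (λ i → geometric (odd i) (suc B)) 0 N
    E⁺ = ∏ (λ i → 1# + even i) 1 N
    E⁻ = ∏ (λ i → 1# + - even i) 1 N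
    Eᵍ = ∏ (λ i → geometric (even i) (suc B′)) 1 N

  -- Sums over multiplicity vectors as Euler products

  ι : Bool → Carrier
  ι true  = 1#
  ι false = 0#

  ι-∧ : ∀ a b → ι (a ∧ b) ≈ ι a * ι b
  ι-∧ true  b = sym (*-identityˡ (ι b))
  ι-∧ false b = sym (zeroˡ (ι b))

  module _ {A : Set} where

    ∑ : (A → Carrier) → List A → Carrier
    ∑ f []       = 0#
    ∑ f (a ∷ as) = f a + ∑ f as

    ∑-cong : ∀ {f g} → (∀ a → f a ≈ g a) → ∀ as → ∑ f as ≈ ∑ g as
    ∑-cong p []       = refl
    ∑-cong p (a ∷ as) = +-cong (p a) (∑-cong p as)

    ∑-scaleˡ : ∀ x f as → ∑ (λ a → x * f a) as ≈ x * ∑ f as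
    ∑-scaleˡ x f []       = sym (zeroʳ x)
    ∑-scaleˡ x f (a ∷ as) = trans (+-congˡ (∑-scaleˡ x f as)) (sym (distribˡ x _ _))

    ∑-scaleʳ : ∀ x f as → ∑ (λ a → f a * x) as ≈ ∑ f as * x
    ∑-scaleʳ x f []       = sym (zeroˡ x)
    ∑-scaleʳ x f (a ∷ as) = trans (+-congˡ (∑-scaleʳ x f as)) (sym (distribʳ x _ _))

    ∑-++ : ∀ f as bs → ∑ f (as ++ bs) ≈ ∑ f as + ∑ f bs
    ∑-++ f []       bs = sym (+-identityˡ _)
    ∑-++ f (a ∷ as) bs = trans (+-congˡ (∑-++ f as bs)) (sym (+-assoc _ _ _))

  ∑-map : ∀ {A B : Set} (f : B → Carrier) (g : A → B) as → ∑ f (map g as) ≈ ∑ (f ∘ g) as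
  ∑-map f g []       = refl
  ∑-map f g (a ∷ as) = +-congˡ (∑-map f g as)

  ∑-concatMap : ∀ {A B : Set} (f : B → Carrier) (g : A → List B) as →
                ∑ f (concatMap g as) ≈ ∑ (λ a → ∑ f (g a)) as
  ∑-concatMap f g []       = refl
  ∑-concatMap f g (a ∷ as) = trans (∑-++ f (g a) (concatMap g as)) (+-congˡ (∑-concatMap f g as))

  -- Both `f` and the prefactor `x` vary because `applyUpTo` recurses on `f ∘ suc`, which turns `x`
  -- into `x * y`.
  ∑-geometric : ∀ (g : ℕ → Carrier) (f : ℕ → ℕ) x y B → (∀ i → g (f i) ≈ x * y ^ i) →
                ∑ g (applyUpTo f B) ≈ x * geometric y B
  ∑-geometric g f x y zero    p = sym (zeroʳ x)
  ∑-geometric g f x y (suc B) p = begin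
    g (f 0) + ∑ g (applyUpTo (f ∘ suc) B)
      ≈⟨ +-cong (p 0) (∑-geometric g (f ∘ suc) (x * y) y B (λ i → trans (p (suc i)) (sym (*-assoc x y _)))) ⟩
    x * 1# + x * y * geometric y B
      ≈⟨ solve 3 (λ x y z → x :* con 1 :+ x :* y :* z := x :* (con 1 :+ y :* z)) refl x y (geometric y B) ⟩
    x * (1# + y * geometric y B) ∎

  module GeneratingFunction (P : ℕ → ℕ → Bool) (x : Carrier) where

    slotTerm : ℕ → Slot → Carrier
    slotTerm j (m , o) = ι (validSlot (m , o) ∧ P j m) * x ^ (j ℕ.* m)

    vecTerm : ∀ {L} → ℕ → Vec Slot L → Carrier
    vecTerm j v = ι (valid v ∧ allowed P j v) * x ^ weight j v

    vecTerm-∷ : ∀ {L} j s (v : Vec Slot L) → vecTerm j (s ∷ v) ≈ slotTerm j s * vecTerm (suc j) v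
    vecTerm-∷ j s@(m , o) v = begin
      ι ((a ∧ b) ∧ (a′ ∧ b′)) * x ^ (j ℕ.* m ℕ.+ weight (suc j) v)
        ≈⟨ *-cong (trans (ι-∧ (a ∧ b) (a′ ∧ b′)) (*-cong (ι-∧ a b) (ι-∧ a′ b′))) (^-homo-* x (j ℕ.* m) _) ⟩
      ι a * ι b * (ι a′ * ι b′) * (x ^ (j ℕ.* m) * x ^ weight (suc j) v)
        ≈⟨ solve 6 (λ a b a′ b′ y z → a :* b :* (a′ :* b′) :* (y :* z) := a :* a′ :* y :* (b :* b′ :* z)) refl
             (ι a) (ι b) (ι a′) (ι b′) (x ^ (j ℕ.* m)) (x ^ weight (suc j) v) ⟩
      ι a * ι a′ * x ^ (j ℕ.* m) * (ι b * ι b′ * x ^ weight (suc j) v)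
        ≈⟨ *-cong (*-congʳ (ι-∧ a a′)) (*-congʳ (ι-∧ b b′)) ⟨
      ι (a ∧ a′) * x ^ (j ℕ.* m) * (ι (b ∧ b′) * x ^ weight (suc j) v) ∎
      where
      a = validSlot s
      b = valid v
      a′ = P j m
      b′ = allowed P (suc j) v

    -- Euler's argument: `vecTerm` is multiplicative over slots and the vectors form a full
    -- Cartesian product, so the sum distributes into one factor per part size.
    ∑-vecs : ∀ L B j → ∑ (vecTerm j) (allVecs L B) ≈ ∏ (λ k → ∑ (slotTerm k) (allSlots B)) j L
    ∑-vecs zero    B j = solve 0 (con 1 :* con 1 :+ con 0 := con 1) refl
    ∑-vecs (suc L) B j = begin
      ∑ (vecTerm j) (concatMap (λ s → map (s ∷_) vs) slots)
        ≈⟨ ∑-concatMap (vecTerm j) (λ s → map (s ∷_) vs) slots ⟩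
      ∑ (λ s → ∑ (vecTerm j) (map (s ∷_) vs)) slots
        ≈⟨ ∑-cong (λ s → trans (∑-map (vecTerm j) (s ∷_) vs)
             (trans (∑-cong (vecTerm-∷ j s) vs) (∑-scaleˡ (slotTerm j s) (vecTerm (suc j)) vs))) slots ⟩
      ∑ (λ s → slotTerm j s * ∑ (vecTerm (suc j)) vs) slots
        ≈⟨ ∑-scaleʳ _ (slotTerm j) slots ⟩
      ∑ (slotTerm j) slots * ∑ (vecTerm (suc j)) vs
        ≈⟨ *-congˡ (∑-vecs L B (suc j)) ⟩
      ∑ (slotTerm j) slots * ∏ (λ k → ∑ (slotTerm k) slots) (suc j) L ∎
      where
      slots = allSlots B
      vs = allVecs L B

    -- Multiplicity 0 is split off because its overlined slot is invalid, so it counts once, while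
    -- each positive multiplicity counts twice. The flag `b` switches the positive ones on for
    -- allowed part sizes and off for forbidden ones.
    ∑-slots : ∀ B j b → P j 0 ≡ true → (∀ i → P j (suc i) ≡ b) →
              ∑ (slotTerm j) (allSlots B) ≈ 1# + ι b * (2# * (x ^ j * geometric (x ^ j) B))
    ∑-slots B j b P0 P+ = begin
      ∑ (slotTerm j) (allSlots B)
        ≈⟨ ∑-concatMap (slotTerm j) (λ m → (m , false) ∷ (m , true) ∷ []) (upTo (suc B)) ⟩
      g 0 + ∑ g (applyUpTo suc B)
        ≈⟨ +-cong g0 (∑-geometric g suc (2# * ι b * x ^ j) (x ^ j) B g+) ⟩
      1# + 2# * ι b * x ^ j * geometric (x ^ j) B
        ≈⟨ +-congˡ (solve 3 (λ c y z → con 2 :* c :* y :* z := c :* (con 2 :* (y :* z))) refl (ι b) (x ^ j) (geometric (x ^ j) B)) ⟩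
      1# + ι b * (2# * (x ^ j * geometric (x ^ j) B)) ∎
      where
      g : ℕ → Carrier
      g m = slotTerm j (m , false) + (slotTerm j (m , true) + 0#)
      g0 : g 0 ≈ 1#
      g0 rewrite P0 | ℕₚ.*-zeroʳ j =
        solve 0 (con 1 :* con 1 :+ (con 0 :* con 1 :+ con 0) := con 1) refl
      g+ : ∀ i → g (suc i) ≈ 2# * ι b * x ^ j * (x ^ j) ^ i
      g+ i rewrite P+ i = trans
        (solve 2 (λ c z → c :* z :+ (c :* z :+ con 0) := con 2 :* c :* z) refl (ι b) (x ^ (j ℕ.* suc i)))
        (trans (*-congˡ (sym (^-assocʳ x j (suc i)))) (sym (*-assoc _ _ _)))

    ∑-slots-free : ∀ B j → (∀ i → P j i ≡ true) → ∑ (slotTerm j) (allSlots B) ≈ slot B (x ^ j)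
    ∑-slots-free B j p = trans (∑-slots B j true (p 0) (p ∘ suc)) (+-congˡ (*-identityˡ _))

    ∑-slots-empty : ∀ B j → P j 0 ≡ true → (∀ i → P j (suc i) ≡ false) → ∑ (slotTerm j) (allSlots B) ≈ 1#
    ∑-slots-empty B j p r = trans (∑-slots B j false p r) (trans (+-congˡ (zeroˡ _)) (+-identityʳ 1#))

  -- Nilpotent powers and enlarging the box

  ^-nil : ∀ {x m} → x ^ m ≈ 0# → ∀ {k} → m ℕ.≤ k → x ^ k ≈ 0#
  ^-nil {x} {m} nil {k} m≤k = begin
    x ^ k                   ≡⟨ ≡.cong (x ^_) (ℕₚ.m+[n∸m]≡n m≤k) ⟨
    x ^ (m ℕ.+ (k ℕ.∸ m))   ≈⟨ ^-homo-* x m (k ℕ.∸ m) ⟩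
    x ^ m * x ^ (k ℕ.∸ m)   ≈⟨ *-congʳ nil ⟩
    0# * x ^ (k ℕ.∸ m)      ≈⟨ zeroˡ _ ⟩
    0#                      ∎

  ^-^-nil : ∀ {x m} → x ^ m ≈ 0# → ∀ k {l} → 1 ℕ.≤ k → m ℕ.≤ l → (x ^ k) ^ l ≈ 0#
  ^-^-nil {x} nil k {l} 1≤k m≤l = trans (^-assocʳ x k l)
    (^-nil nil (ℕₚ.≤-trans m≤l (ℕₚ.m≤n*m l k {{ℕ.>-nonZero 1≤k}})))

  -- Each enlargement adds a part size whose power of `x` vanishes, so its factor is 1, and one more
  -- multiplicity, whose term vanishes by `geometric-stable`.
  ∏-slot-stable : ∀ {x} m → x ^ suc m ≈ 0# → ∀ d →
    ∏ (λ k → slot (d ℕ.+ m) (x ^ k)) 1 (d ℕ.+ m) ≈ ∏ (λ k → slot m (x ^ k)) 1 m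
  ∏-slot-stable     m nil zero    = refl
  ∏-slot-stable {x} m nil (suc d) = begin
    ∏ (λ k → slot (suc B) (x ^ k)) 1 (suc B)
      ≈⟨ ∏-snoc (λ k → slot (suc B) (x ^ k)) 1 B ⟩
    ∏ (λ k → slot (suc B) (x ^ k)) 1 B * slot (suc B) (x ^ suc B)
      ≈⟨ *-cong (∏-cong 1 B (λ k 1≤k → +-congˡ (*-congˡ (geometric-stable (x ^ k) B (^-^-nil nil k 1≤k m<1+B)))))
                (+-congˡ (trans (*-congˡ (trans (*-congʳ (^-nil nil m<1+B)) (zeroˡ _))) (zeroʳ 2#))) ⟩
    ∏ (λ k → slot B (x ^ k)) 1 B * (1# + 0#)
      ≈⟨ trans (*-congˡ (+-identityʳ 1#)) (*-identityʳ _) ⟩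
    ∏ (λ k → slot B (x ^ k)) 1 B
      ≈⟨ ∏-slot-stable m nil d ⟩
    ∏ (λ k → slot m (x ^ k)) 1 m ∎
    where
    B = d ℕ.+ m
    m<1+B : suc m ℕ.≤ suc B
    m<1+B = s≤s (ℕₚ.m≤n+m m d)

-- Truncated power series

open import Data.Nat using (_+_; _*_)
open import Relation.Binary.PropositionalEquality using (refl; sym; trans; cong; cong₂; subst; module ≡-Reasoning)

Series : Set
Series = ℕ → ℤ

tail : Series → Series
tail f = f ∘ suc

infixl 7 _⊛_
infixl 6 _⊞_

_⊞_ : Series → Series → Series
(f ⊞ g) n = f n ℤ.+ g n

⊟_ : Series → Series
(⊟ f) n = ℤ.- f n

one : Series
one zero    = + 1
one (suc _) = + 0

-- The Cauchy product through f = f(0) + x · `tail f`, so that the ring laws become inductions on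
-- the index instead of manipulations of double sums.
_⊛_ : Series → Series → Series
(f ⊛ g) zero    = f 0 ℤ.* g 0
(f ⊛ g) (suc n) = f 0 ℤ.* g (suc n) ℤ.+ (tail f ⊛ g) n

-- The mirror image of the defining recursion; commutativity follows by matching the two.
⊛-tailʳ : ∀ f g n → (f ⊛ g) (suc n) ≡ f (suc n) ℤ.* g 0 ℤ.+ (f ⊛ tail g) n
⊛-tailʳ f g zero    = ℤₚ.+-comm (f 0 ℤ.* g 1) (f 1 ℤ.* g 0)
⊛-tailʳ f g (suc n) = begin
  f 0 ℤ.* g (suc (suc n)) ℤ.+ (tail f ⊛ g) (suc n)
    ≡⟨ cong (ℤ._+_ (f 0 ℤ.* g (suc (suc n)))) (⊛-tailʳ (tail f) g n) ⟩
  f 0 ℤ.* g (suc (suc n)) ℤ.+ (f (suc (suc n)) ℤ.* g 0 ℤ.+ (tail f ⊛ tail g) n)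
    ≡⟨ x+[y+z]≡y+[x+z] (f 0 ℤ.* g (suc (suc n))) (f (suc (suc n)) ℤ.* g 0) _ ⟩
  f (suc (suc n)) ℤ.* g 0 ℤ.+ (f ⊛ tail g) (suc n) ∎
  where
  open ≡-Reasoning
  x+[y+z]≡y+[x+z] : ∀ x y z → x ℤ.+ (y ℤ.+ z) ≡ y ℤ.+ (x ℤ.+ z)
  x+[y+z]≡y+[x+z] = ℤ-solve-∀

⊛-comm : ∀ f g n → (f ⊛ g) n ≡ (g ⊛ f) n
⊛-comm f g zero    = ℤₚ.*-comm (f 0) (g 0)
⊛-comm f g (suc n) = trans
  (cong₂ ℤ._+_ (ℤₚ.*-comm (f 0) (g (suc n))) (⊛-comm (tail f) g n))
  (sym (⊛-tailʳ g f n))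

-- The result at index n depends only on the arguments at indices ≤ n,
-- so multiplication respects truncation.
⊛-cong-≤ : ∀ {f f′ g g′} n → (∀ i → i ℕ.≤ n → f i ≡ f′ i) → (∀ i → i ℕ.≤ n → g i ≡ g′ i) →
           (f ⊛ g) n ≡ (f′ ⊛ g′) n
⊛-cong-≤ zero    p r = cong₂ ℤ._*_ (p 0 z≤n) (r 0 z≤n)
⊛-cong-≤ (suc n) p r = cong₂ ℤ._+_
  (cong₂ ℤ._*_ (p 0 z≤n) (r (suc n) ℕₚ.≤-refl))
  (⊛-cong-≤ n (λ i i≤n → p (suc i) (s≤s i≤n)) (λ i i≤n → r i (ℕₚ.m≤n⇒m≤1+n i≤n)))

⊛-cong : ∀ {f f′ g g′} → (∀ i → f i ≡ f′ i) → (∀ i → g i ≡ g′ i) → ∀ n → (f ⊛ g) n ≡ (f′ ⊛ g′) n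
⊛-cong p r n = ⊛-cong-≤ n (λ i _ → p i) (λ i _ → r i)

⊛-distribʳ : ∀ h f g n → ((f ⊞ g) ⊛ h) n ≡ (f ⊛ h) n ℤ.+ (g ⊛ h) n
⊛-distribʳ h f g zero    = ℤₚ.*-distribʳ-+ (h 0) (f 0) (g 0)
⊛-distribʳ h f g (suc n) = trans
  (cong (ℤ._+_ ((f 0 ℤ.+ g 0) ℤ.* h (suc n))) (⊛-distribʳ h (tail f) (tail g) n))
  (rearrange (f 0) (g 0) (h (suc n)) _ _)
  where
  rearrange : ∀ a b c x y → (a ℤ.+ b) ℤ.* c ℤ.+ (x ℤ.+ y) ≡ a ℤ.* c ℤ.+ x ℤ.+ (b ℤ.* c ℤ.+ y)
  rearrange = ℤ-solve-∀

⊛-distribˡ : ∀ h f g n → (h ⊛ (f ⊞ g)) n ≡ (h ⊛ f) n ℤ.+ (h ⊛ g) n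
⊛-distribˡ h f g n = trans (⊛-comm h (f ⊞ g) n)
  (trans (⊛-distribʳ h f g n) (cong₂ ℤ._+_ (⊛-comm f h n) (⊛-comm g h n)))

⊛-scale : ∀ c f g n → ((λ i → c ℤ.* f i) ⊛ g) n ≡ c ℤ.* (f ⊛ g) n
⊛-scale c f g zero    = ℤₚ.*-assoc c (f 0) (g 0)
⊛-scale c f g (suc n) = trans
  (cong₂ ℤ._+_ (ℤₚ.*-assoc c (f 0) (g (suc n))) (⊛-scale c (tail f) g n))
  (sym (ℤₚ.*-distribˡ-+ c (f 0 ℤ.* g (suc n)) _))

⊛-assoc : ∀ f g h n → ((f ⊛ g) ⊛ h) n ≡ (f ⊛ (g ⊛ h)) n
⊛-assoc f g h zero    = ℤₚ.*-assoc (f 0) (g 0) (h 0)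
⊛-assoc f g h (suc n) = begin
  f 0 ℤ.* g 0 ℤ.* h (suc n) ℤ.+ (tail (f ⊛ g) ⊛ h) n
    ≡⟨ cong (ℤ._+_ (f 0 ℤ.* g 0 ℤ.* h (suc n))) (⊛-distribʳ h (λ i → f 0 ℤ.* g (suc i)) (tail f ⊛ g) n) ⟩
  f 0 ℤ.* g 0 ℤ.* h (suc n) ℤ.+ (((λ i → f 0 ℤ.* g (suc i)) ⊛ h) n ℤ.+ ((tail f ⊛ g) ⊛ h) n)
    ≡⟨ cong (ℤ._+_ (f 0 ℤ.* g 0 ℤ.* h (suc n))) (cong₂ ℤ._+_ (⊛-scale (f 0) (tail g) h n) (⊛-assoc (tail f) g h n)) ⟩
  f 0 ℤ.* g 0 ℤ.* h (suc n) ℤ.+ (f 0 ℤ.* (tail g ⊛ h) n ℤ.+ (tail f ⊛ (g ⊛ h)) n)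
    ≡⟨ rearrange (f 0) (g 0) (h (suc n)) _ _ ⟩
  f 0 ℤ.* (g 0 ℤ.* h (suc n) ℤ.+ (tail g ⊛ h) n) ℤ.+ (tail f ⊛ (g ⊛ h)) n ∎
  where
  open ≡-Reasoning
  rearrange : ∀ a b c x y → a ℤ.* b ℤ.* c ℤ.+ (a ℤ.* x ℤ.+ y) ≡ a ℤ.* (b ℤ.* c ℤ.+ x) ℤ.+ y
  rearrange = ℤ-solve-∀

⊛-zeroˡ : ∀ f n → ((λ _ → + 0) ⊛ f) n ≡ + 0
⊛-zeroˡ f zero    = refl
⊛-zeroˡ f (suc n) = trans (ℤₚ.+-identityˡ _) (⊛-zeroˡ f n)

⊛-identityˡ : ∀ f n → (one ⊛ f) n ≡ f n
⊛-identityˡ f zero    = ℤₚ.*-identityˡ (f 0)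
⊛-identityˡ f (suc n) = trans
  (cong₂ ℤ._+_ (ℤₚ.*-identityˡ (f (suc n))) (⊛-zeroˡ f n))
  (ℤₚ.+-identityʳ (f (suc n)))

-- The quotient of the power series ring by x^M, kept as a setoid: elements are full series, and
-- applying an equality to an index below `M` reads off that coefficient.
truncated : ℕ → CommutativeRing 0ℓ 0ℓ
truncated M = record
  { Carrier = Series
  ; _≈_ = λ f g → ∀ i → i ℕ.< M → f i ≡ g i
  ; _+_ = _⊞_
  ; _*_ = _⊛_
  ; -_ = ⊟_
  ; 0# = λ _ → + 0
  ; 1# = one
  ; isCommutativeRing = record
    { isRing = record
      { +-isAbelianGroup = record
        { isGroup = record
          { isMonoid = record
            { isSemigroup = record
              { isMagma = record
                { isEquivalence = record
                  { refl  = λ _ _ → refl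
                  ; sym   = λ p i i<M → sym (p i i<M)
                  ; trans = λ p r i i<M → trans (p i i<M) (r i i<M)
                  }
                ; ∙-cong = λ p r i i<M → cong₂ ℤ._+_ (p i i<M) (r i i<M)
                }
              ; assoc = λ f g h i _ → ℤₚ.+-assoc (f i) (g i) (h i)
              }
            ; identity = (λ f i _ → ℤₚ.+-identityˡ (f i))
                       , (λ f i _ → ℤₚ.+-identityʳ (f i))
            }
          ; inverse = (λ f i _ → ℤₚ.+-inverseˡ (f i))
                    , (λ f i _ → ℤₚ.+-inverseʳ (f i))
          ; ⁻¹-cong = λ p i i<M → cong ℤ.-_ (p i i<M)
          }
        ; comm = λ f g i _ → ℤₚ.+-comm (f i) (g i)
        }
      ; *-cong = λ p r i i<M → ⊛-cong-≤ i (λ k k≤i → p k (ℕₚ.≤-<-trans k≤i i<M))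
                                         (λ k k≤i → r k (ℕₚ.≤-<-trans k≤i i<M))
      ; *-assoc = λ f g h i _ → ⊛-assoc f g h i
      ; *-identity = (λ f i _ → ⊛-identityˡ f i)
                   , (λ f i _ → trans (⊛-comm f one i) (⊛-identityˡ f i))
      ; distrib = (λ f g h i _ → ⊛-distribˡ f g h i) , (λ f g h i _ → ⊛-distribʳ f g h i)
      }
    ; *-comm = λ f g i _ → ⊛-comm f g i
    }
  }

X : Series
X zero          = + 0
X (suc zero)    = + 1
X (suc (suc _)) = + 0

X⊛-suc : ∀ f n → (X ⊛ f) (suc n) ≡ f n
X⊛-suc f n = trans (ℤₚ.+-identityˡ _) (trans (⊛-cong {g = f} tail-X (λ _ → refl) n) (⊛-identityˡ f n))
  where
  tail-X : ∀ i → tail X i ≡ one i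
  tail-X zero    = refl
  tail-X (suc _) = refl

-- Overpartition counts as coefficients

-- Shaped so that `pbar` and `pbarO` unfold to instances of it.
count : ∀ {A : Set} → (A → Bool) → List A → ℕ
count p as = length (filter (λ a → p a ≟ true) as)

indicator : Bool → ℕ
indicator true  = 1
indicator false = 0

count-∷ : ∀ {A : Set} (p : A → Bool) a as → count p (a ∷ as) ≡ indicator (p a) + count p as
count-∷ p a as with p a
... | true  = refl
... | false = refl

count-cong : ∀ {A : Set} {p r : A → Bool} → (∀ a → p a ≡ r a) → ∀ as → count p as ≡ count r as
count-cong         eq []       = refl
count-cong {p = p} {r} eq (a ∷ as) = trans (count-∷ p a as)
  (trans (cong₂ _+_ (cong indicator (eq a)) (count-cong eq as)) (sym (count-∷ r a as)))

count-none : ∀ {A : Set} {p : A → Bool} → (∀ a → p a ≡ false) → ∀ as → count p as ≡ 0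
count-none         eq []       = refl
count-none {p = p} eq (a ∷ as) = trans (count-∷ p a as) (cong₂ _+_ (cong indicator (eq a)) (count-none eq as))

module Coefficients (M : ℕ) where
  open CommutativeRing (truncated M) public using (_≈_; *-cong; *-congˡ)
    renaming (refl to ≈-refl; sym to ≈-sym; trans to ≈-trans; _*_ to _·_)
  open CommutativeRing (truncated M) using (commutativeSemiring)
  open import Algebra.Properties.CommutativeSemiring.Exp commutativeSemiring public
  open Identities (truncated M) public

  X^-coeff : ∀ e m → (X ^ e) m ≡ + indicator (e ≡ᵇ m)
  X^-coeff zero    zero    = refl
  X^-coeff zero    (suc m) = refl
  X^-coeff (suc e) zero    = refl
  X^-coeff (suc e) (suc m) = trans (X⊛-suc (X ^ e) m) (X^-coeff e m)

  ι-X^-coeff : ∀ b e m → (ι b ⊛ X ^ e) m ≡ + indicator (b ∧ (e ≡ᵇ m))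
  ι-X^-coeff true  e m = trans (⊛-identityˡ (X ^ e) m) (X^-coeff e m)
  ι-X^-coeff false e m = ⊛-zeroˡ (X ^ e) m

  X^-nil : ∀ {k} → M ℕ.≤ k → (X ^ k) ≈ (λ _ → + 0)
  X^-nil {k} M≤k i i<M = trans (X^-coeff k i) (cong (+_ ∘ indicator) (≡ᵇ-false k i (ℕₚ.<-≤-trans i<M M≤k)))
    where
    ≡ᵇ-false : ∀ k i → i ℕ.< k → (k ≡ᵇ i) ≡ false
    ≡ᵇ-false (suc k) zero    _         = refl
    ≡ᵇ-false (suc k) (suc i) (s≤s i<k) = ≡ᵇ-false k i i<k

  ∑-coeff : ∀ {A : Set} (F : A → Series) (p : A → Bool) (e : A → ℕ) m → m ℕ.< M → (∀ a → F a ≈ (ι (p a) ⊛ X ^ e a)) →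
            ∀ as → ∑ F as m ≡ + count (λ a → p a ∧ (e a ≡ᵇ m)) as
  ∑-coeff F p e m m<M F≈ []       = refl
  ∑-coeff F p e m m<M F≈ (a ∷ as) = trans
    (cong₂ ℤ._+_ (trans (F≈ a m m<M) (ι-X^-coeff (p a) (e a) m)) (∑-coeff F p e m m<M F≈ as))
    (cong +_ (sym (count-∷ (λ a → p a ∧ (e a ≡ᵇ m)) a as)))

anyMultiplicity : ℕ → ℕ → Bool
anyMultiplicity _ _ = true

allowed-any : ∀ {L} j (v : Vec Slot L) → allowed anyMultiplicity j v ≡ true
allowed-any j []      = refl
allowed-any j (_ ∷ v) = allowed-any (suc j) v

onlyOdd : ℕ → ℕ → Bool
onlyOdd j m = if (j % 2) ≡ᵇ 0 then m ≡ᵇ 0 else true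

allowed-onlyOdd : ∀ {L} j (v : Vec Slot L) → allowed onlyOdd j v ≡ oddParts j v
allowed-onlyOdd j []            = refl
allowed-onlyOdd j ((m , _) ∷ v) = cong (onlyOdd j m ∧_) (allowed-onlyOdd (suc j) v)

-- Two successors cancel in `j % 2` by computation, so the induction hypothesis already has the
-- required type.
onlyOdd-odd : ∀ i m → onlyOdd (suc (double i)) m ≡ true
onlyOdd-odd zero    m = refl
onlyOdd-odd (suc i) m = onlyOdd-odd i m

onlyOdd-even : ∀ i m → onlyOdd (double i) m ≡ (m ≡ᵇ 0)
onlyOdd-even zero    m = refl
onlyOdd-even (suc i) m = onlyOdd-even i m

countOfWeight : ℕ → ℕ → ℕ → ℕ
countOfWeight L B m = count (λ v → valid v ∧ (weight 1 v ≡ᵇ m)) (allVecs L B)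

-- The counts are compared through their generating functions instead of a bijection between
-- enumerations. Modulo X^(m+1) coefficient `m` is still visible, yet parts and multiplicities above
-- `m` already contribute nothing.
countOfWeight-stable : ∀ d m → countOfWeight (d + m) (d + m) m ≡ pbar m
countOfWeight-stable d m = ℤₚ.+-injective (begin
  + countOfWeight (d + m) (d + m) m                        ≡⟨ coeff (d + m) ⟨
  ∏ (λ k → slot (d + m) (X ^ k)) 1 (d + m) m               ≡⟨ ∏-slot-stable {X} m (X^-nil ℕₚ.≤-refl) d m ℕₚ.≤-refl ⟩
  ∏ (λ k → slot m (X ^ k)) 1 m m                           ≡⟨ coeff m ⟩
  + pbar m                                                 ∎)
  where
  open ≡-Reasoning
  open Coefficients (suc m)
  open GeneratingFunction anyMultiplicity X
  coeff : ∀ L → ∏ (λ k → slot L (X ^ k)) 1 L m ≡ + countOfWeight L L m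
  coeff L = begin
    ∏ (λ k → slot L (X ^ k)) 1 L m
      ≡⟨ ∏-cong 1 L (λ k _ → ∑-slots-free L k (λ _ → refl)) m ℕₚ.≤-refl ⟨
    ∏ (λ k → ∑ (slotTerm k) (allSlots L)) 1 L m
      ≡⟨ ∑-vecs L L 1 m ℕₚ.≤-refl ⟨
    ∑ (vecTerm 1) (allVecs L L) m
      ≡⟨ ∑-coeff (vecTerm 1) (λ v → valid v ∧ allowed anyMultiplicity 1 v) (weight 1) m ℕₚ.≤-refl
           (λ v → ≈-refl {vecTerm 1 v}) (allVecs L L) ⟩
    + count (λ v → (valid v ∧ allowed anyMultiplicity 1 v) ∧ (weight 1 v ≡ᵇ m)) (allVecs L L)
      ≡⟨ cong +_ (count-cong (λ v → cong (_∧ (weight 1 v ≡ᵇ m))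
           (trans (cong (valid v ∧_) (allowed-any 1 v)) (∧-identityʳ (valid v)))) (allVecs L L)) ⟩
    + countOfWeight L L m ∎

double≡2* : ∀ n → double n ≡ 2 * n
double≡2* zero    = refl
double≡2* (suc n) = cong suc (trans (cong suc (double≡2* n)) (sym (ℕₚ.+-suc n (n + 0))))

module _ (n : ℕ) where
  open Coefficients (suc (double n))
  open GeneratingFunction onlyOdd X

  -- An even part size admits only multiplicity 0, so its factor is 1; the sizes 1, 3, ..., 2n - 1
  -- remain.
  pbarO-coeff : + pbarO (double n) ≡ ∏ (λ i → slot (double n) (X ^ suc (double i))) 0 n (double n)
  pbarO-coeff = begin
    + pbarO m
      ≡⟨ cong +_ (count-cong (λ v → trans
           (∧-swapʳ (valid v) (weight 1 v ≡ᵇ m) (oddParts 1 v))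
           (cong (λ b → (valid v ∧ b) ∧ (weight 1 v ≡ᵇ m)) (sym (allowed-onlyOdd 1 v)))) (allVecs m m)) ⟩
    + count (λ v → (valid v ∧ allowed onlyOdd 1 v) ∧ (weight 1 v ≡ᵇ m)) (allVecs m m)
      ≡⟨ ∑-coeff (vecTerm 1) (λ v → valid v ∧ allowed onlyOdd 1 v) (weight 1) m ℕₚ.≤-refl
           (λ v → ≈-refl {vecTerm 1 v}) (allVecs m m) ⟨
    ∑ (vecTerm 1) (allVecs m m) m
      ≡⟨ ∑-vecs m m 1 m ℕₚ.≤-refl ⟩
    ∏ slots 1 m m
      ≡⟨ ∏-double slots 0 n m ℕₚ.≤-refl ⟩
    (∏ (slots ∘ suc ∘ double) 0 n · ∏ (slots ∘ double) 1 n) m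
      ≡⟨ *-cong (∏-cong 0 n (λ i _ → ∑-slots-free m (suc (double i)) (onlyOdd-odd i)))
                (∏-1 1 n (λ i _ → ∑-slots-empty m (double i) (onlyOdd-even i 0) (onlyOdd-even i ∘ suc)))
                m ℕₚ.≤-refl ⟩
    (∏ (λ i → slot m (X ^ suc (double i))) 0 n · one) m
      ≡⟨ trans (⊛-comm _ one m) (⊛-identityˡ _ m) ⟩
    ∏ (λ i → slot m (X ^ suc (double i))) 0 n m ∎
    where
    open ≡-Reasoning
    m = double n
    slots : ℕ → Series
    slots k = ∑ (slotTerm k) (allSlots m)
    ∧-swapʳ : ∀ a b c → (a ∧ b) ∧ c ≡ (a ∧ c) ∧ b
    ∧-swapʳ a b c = trans (∧-assoc a b c) (trans (cong (a ∧_) (∧-comm b c)) (sym (∧-assoc a c b)))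

-- Counts overpartitions of n - a/2, phrased without subtraction or halving.
shiftedCount : ℕ → ℕ → ℕ
shiftedCount n a = count (λ v → valid v ∧ (a + double (weight 1 v) ≡ᵇ double n)) (allVecs n n)

module _ (n : ℕ) where
  open Coefficients (suc (double n))
  open GeneratingFunction anyMultiplicity (X · X)
  private
    -- P(q²) is obtained by using `X · X` as the variable. The box of `n` suffices, since degree at
    -- most 2n means weight at most `n`.
    S : Series
    S = ∑ (vecTerm 1) (allVecs n n)

  X^-shift-coeff : ∀ a → (X ^ a ⊛ S) (double n) ≡ + shiftedCount n a
  X^-shift-coeff a = begin
    (X ^ a ⊛ S) (double n)
      ≡⟨ ∑-scaleˡ (X ^ a) (vecTerm 1) (allVecs n n) (double n) ℕₚ.≤-refl ⟨
    ∑ (λ v → X ^ a ⊛ vecTerm 1 v) (allVecs n n) (double n)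
      ≡⟨ ∑-coeff (λ v → X ^ a ⊛ vecTerm 1 v) valid (λ v → a + double (weight 1 v)) (double n) ℕₚ.≤-refl
           (λ v → shift v) (allVecs n n) ⟩
    + shiftedCount n a ∎
    where
    open ≡-Reasoning
    shift : ∀ (v : Vec Slot n) → (X ^ a ⊛ vecTerm 1 v) ≈ (ι (valid v) ⊛ X ^ (a + double (weight 1 v)))
    shift v i i<M = begin
      (X ^ a ⊛ (ι (valid v ∧ allowed anyMultiplicity 1 v) ⊛ (X · X) ^ w)) i
        ≡⟨ cong (λ b → (X ^ a ⊛ (ι b ⊛ (X · X) ^ w)) i) (trans (cong (valid v ∧_) (allowed-any 1 v)) (∧-identityʳ _)) ⟩
      (X ^ a ⊛ (ι (valid v) ⊛ (X · X) ^ w)) i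
        ≡⟨ ⊛-assoc (X ^ a) (ι (valid v)) ((X · X) ^ w) i ⟨
      (X ^ a ⊛ ι (valid v) ⊛ (X · X) ^ w) i
        ≡⟨ *-cong {X ^ a ⊛ ι (valid v)} {ι (valid v) ⊛ X ^ a} (λ k _ → ⊛-comm (X ^ a) (ι (valid v)) k)
                  (square-^-double X w) i i<M ⟩
      (ι (valid v) ⊛ X ^ a ⊛ X ^ double w) i
        ≡⟨ ⊛-assoc (ι (valid v)) (X ^ a) (X ^ double w) i ⟩
      (ι (valid v) ⊛ (X ^ a ⊛ X ^ double w)) i
        ≡⟨ *-congˡ {ι (valid v)} (^-homo-* X a (double w)) i i<M ⟨
      (ι (valid v) ⊛ X ^ (a + double w)) i ∎
      where w = weight 1 v

  θ-coeff : ∀ k → (θ X k ⊛ S) (double n) ≡ + (shiftedCount n 0 + 2 * sumFrom1 k (λ j → shiftedCount n (j * j)))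
  θ-coeff zero    = trans (X^-shift-coeff 0) (cong +_ (sym (ℕₚ.+-identityʳ _)))
  θ-coeff (suc k) = begin
    ((θ X k ⊞ (2# ⊛ X ^ a)) ⊛ S) (double n)
      ≡⟨ ⊛-distribʳ S (θ X k) (2# ⊛ X ^ a) (double n) ⟩
    (θ X k ⊛ S) (double n) ℤ.+ (2# ⊛ X ^ a ⊛ S) (double n)
      ≡⟨ cong₂ ℤ._+_ (θ-coeff k) (trans (⊛-assoc 2# (X ^ a) S (double n))
           (trans (⊛-distribʳ (X ^ a ⊛ S) one one (double n))
             (cong₂ ℤ._+_ double-shift double-shift))) ⟩
    + (shiftedCount n 0 + 2 * s + (shiftedCount n a + shiftedCount n a))
      ≡⟨ cong +_ (rearrange (shiftedCount n 0) s (shiftedCount n a)) ⟩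
    + (shiftedCount n 0 + 2 * (s + shiftedCount n a)) ∎
    where
    open ≡-Reasoning
    a = suc k * suc k
    s = sumFrom1 k (λ j → shiftedCount n (j * j))
    double-shift : (one ⊛ (X ^ a ⊛ S)) (double n) ≡ + shiftedCount n a
    double-shift = trans (⊛-identityˡ (X ^ a ⊛ S) (double n)) (X^-shift-coeff a)
    rearrange : ∀ x y z → x + 2 * y + (z + z) ≡ x + 2 * (y + z)
    rearrange = ℕ-solve-∀

  even-slots-coeff : ∀ k → (θ X k ⊛ ∏ (λ i → slot n (X ^ double i)) 1 n) (double n) ≡ (θ X k ⊛ S) (double n)
  even-slots-coeff k = *-congˡ {θ X k} even-slots (double n) ℕₚ.≤-refl
    where
    slots≈ : ∀ i → slot n ((X · X) ^ i) ≈ slot n (X ^ double i)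
    slots≈ i = slot-cong n (square-^-double X i)
    even-slots : ∏ (λ i → slot n (X ^ double i)) 1 n ≈ S
    even-slots = ≈-sym {S} (≈-trans {S} (∑-vecs n n 1)
      (∏-cong 1 n (λ i _ → ≈-trans {∑ (slotTerm i) (allSlots n)} (∑-slots-free n i (λ _ → refl)) (slots≈ i))))

  odd-even-coeff : ∏ (λ i → slot (double n) (X ^ suc (double i))) 0 n (double n) ≡
                   (θ X (double n) ⊛ ∏ (λ i → slot n (X ^ double i)) 1 n) (double n)
  odd-even-coeff = odd≈θ*even X n (double n) n (X^-nil ℕₚ.≤-refl)
    (λ i → ^-^-nil {X} {suc (double n)} (X^-nil ℕₚ.≤-refl) (suc (double i)) (s≤s z≤n) ℕₚ.≤-refl)
    nil-even (double n) ℕₚ.≤-refl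
    where
    nil-even : ∀ i → 1 ℕ.≤ i → ((X ^ double i) ^ suc n) ≈ (λ _ → + 0)
    nil-even (suc i) _ = ≈-trans {(X ^ double (suc i)) ^ suc n} (^-assocʳ X (double (suc i)) (suc n))
      -- An even size is at least 2, so the exponent is at least 2(n + 1), above 2n. This is why
      -- multiplicity bound `n` suffices here, while the odd sizes, which start at 1, use 2n.
      (X^-nil (ℕₚ.≤-trans (ℕₚ.≤-trans (ℕₚ.n≤1+n _) (ℕₚ.≤-reflexive (double≡2* (suc n))))
                          (ℕₚ.*-monoˡ-≤ (suc n) {2} {double (suc i)} (s≤s (s≤s z≤n)))))

-- Parity of the squares and evaluation of the shifted counts

double-+ : ∀ a b → double a + double b ≡ double (a + b)
double-+ zero    b = refl
double-+ (suc a) b = cong (suc ∘ suc) (double-+ a b)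

double-≡ᵇ : ∀ a b → (double a ≡ᵇ double b) ≡ (a ≡ᵇ b)
double-≡ᵇ zero    zero    = refl
double-≡ᵇ zero    (suc b) = refl
double-≡ᵇ (suc a) zero    = refl
double-≡ᵇ (suc a) (suc b) = double-≡ᵇ a b

suc-double-≢ᵇ : ∀ a b → (suc (double a) ≡ᵇ double b) ≡ false
suc-double-≢ᵇ a       zero    = refl
suc-double-≢ᵇ zero    (suc b) = refl
suc-double-≢ᵇ (suc a) (suc b) = suc-double-≢ᵇ a b

+-≡ᵇ : ∀ s a b → (s + a ≡ᵇ s + b) ≡ (a ≡ᵇ b)
+-≡ᵇ zero    a b = refl
+-≡ᵇ (suc s) a b = +-≡ᵇ s a b

≢ᵇ-> : ∀ s a n → n ℕ.< s → (s + a ≡ᵇ n) ≡ false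
≢ᵇ-> (suc s) a zero    _         = refl
≢ᵇ-> (suc s) a (suc n) (s≤s n<s) = ≢ᵇ-> s a n n<s

shiftedCount-odd : ∀ n a → shiftedCount n (suc (double a)) ≡ 0
shiftedCount-odd n a = count-none (λ v → trans
  (cong (valid v ∧_) (trans (cong (λ k → suc k ≡ᵇ double n) (double-+ a (weight 1 v))) (suc-double-≢ᵇ (a + weight 1 v) n)))
  (∧-zeroʳ (valid v))) (allVecs n n)

shiftedCount-double : ∀ n s → shiftedCount n (double s) ≡ count (λ v → valid v ∧ (s + weight 1 v ≡ᵇ n)) (allVecs n n)
shiftedCount-double n s = count-cong (λ v → cong (valid v ∧_)
  (trans (cong (_≡ᵇ double n) (double-+ s (weight 1 v))) (double-≡ᵇ (s + weight 1 v) n))) (allVecs n n)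

-- A shift beyond `n` leaves no possible weight, in accordance with the value 0 of `pbarℤ` at
-- negative integers. Otherwise the weight is forced to be n - s.
shiftedCount-even : ∀ n s → shiftedCount n (double s) ≡ pbarℤ (+ n - + s)
shiftedCount-even n s with ℕₚ.<-≤-connex n s
... | inj₁ n<s = trans (shiftedCount-double n s)
  (trans (count-none (λ v → trans (cong (valid v ∧_) (≢ᵇ-> s (weight 1 v) n n<s)) (∧-zeroʳ (valid v))) (allVecs n n))
         (sym (pbarℤ-neg n<s)))
  where
  pbarℤ-neg : ∀ {n s} → n ℕ.< s → pbarℤ (+ n - + s) ≡ 0
  pbarℤ-neg {n} {s} n<s rewrite ℤₚ.m-n≡m⊖n n s | ℤₚ.⊖-< n<s with s ℕ.∸ n | ℕₚ.m<n⇒0<n∸m n<s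
  ... | suc _ | _ = refl
... | inj₂ s≤n = begin
  shiftedCount n (double s)
    ≡⟨ shiftedCount-double n s ⟩
  count (λ v → valid v ∧ (s + weight 1 v ≡ᵇ n)) (allVecs n n)
    ≡⟨ count-cong (λ v → cong (valid v ∧_)
         (trans (cong (s + weight 1 v ≡ᵇ_) (sym (ℕₚ.m+[n∸m]≡n s≤n))) (+-≡ᵇ s (weight 1 v) m))) (allVecs n n) ⟩
  countOfWeight n n m
    -- The vectors still range over the box of `n`, that is of s + m, whereas `pbar m` uses the box
    -- of `m`.
    ≡⟨ subst (λ k → countOfWeight k k m ≡ pbar m) (ℕₚ.m+[n∸m]≡n s≤n) (countOfWeight-stable s m) ⟩
  pbar m
    ≡⟨ cong pbarℤ (trans (ℤₚ.m-n≡m⊖n n s) (ℤₚ.⊖-≥ s≤n)) ⟨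
  pbarℤ (+ n - + s) ∎
  where
  open ≡-Reasoning
  m = n ℕ.∸ s

sumFrom1-double : ∀ (f g : ℕ → ℕ) → (∀ i → f (suc (double i)) ≡ 0) → (∀ i → f (double i) ≡ g i) →
                  ∀ k → sumFrom1 (double k) f ≡ sumFrom1 k g
sumFrom1-double f g odd even zero    = refl
sumFrom1-double f g odd even (suc k) = cong₂ _+_
  (trans (cong (_+_ (sumFrom1 (double k) f)) (odd k)) (trans (ℕₚ.+-identityʳ _) (sumFrom1-double f g odd even k)))
  (even (suc k))

double-square : ∀ k → double k * double k ≡ double (2 * (k * k))
double-square k rewrite double≡2* (2 * (k * k)) | double≡2* k = lemma k
  where
  lemma : ∀ k → 2 * k * (2 * k) ≡ 2 * (2 * (k * k))
  lemma = ℕ-solve-∀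

suc-double-square : ∀ k → suc (double k) * suc (double k) ≡ suc (double (2 * (k * k) + 2 * k))
suc-double-square k rewrite double≡2* (2 * (k * k) + 2 * k) | double≡2* k = lemma k
  where
  lemma : ∀ k → suc (2 * k) * suc (2 * k) ≡ suc (2 * (2 * (k * k) + 2 * k))
  lemma = ℕ-solve-∀

theorem3p7 : (n : ℕ) →
    pbarO (2 * n) ≡ pbar n + 2 * sumFrom1 n (λ k → pbarℤ (+ n - + (2 * (k * k))))
theorem3p7 n = begin
  pbarO (2 * n)
    ≡⟨ cong pbarO (double≡2* n) ⟨
  pbarO (double n)
    ≡⟨ ℤₚ.+-injective (trans (pbarO-coeff n)
         (trans (odd-even-coeff n) (trans (even-slots-coeff n (double n)) (θ-coeff n (double n))))) ⟩
  shiftedCount n 0 + 2 * sumFrom1 (double n) (λ j → shiftedCount n (j * j))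
    ≡⟨ cong₂ (λ a b → a + 2 * b)
         (shiftedCount-double n 0)
         -- The theta series was cut at j = 2n, so its even indices j = 2k are exactly those with k
         -- ≤ n. Odd j have odd squares, and no even degree completes these to 2n.
         (sumFrom1-double _ _
           (λ i → trans (cong (shiftedCount n) (suc-double-square i)) (shiftedCount-odd n (2 * (i * i) + 2 * i)))
           (λ i → trans (cong (shiftedCount n) (double-square i)) (shiftedCount-even n (2 * (i * i))))
           n) ⟩
  pbar n + 2 * sumFrom1 n (λ k → pbarℤ (+ n - + (2 * (k * k)))) ∎
  where open ≡-Reasoning
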